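{- Let $(\mathcal{B},\rho_{\mathcal B})$, $(\mathcal{G},\rho_{\mathcal G})$ and $(\mathcal{R},\rho_{\mathcal R})$ be, respectively, the pseudometric spaces of all base structures, of all gadgets, and of all $L$-structures (of arbitrary cardinality), each equipped with the elementary-equivalence pseudometric. Equip $\mathcal{B}\times\mathcal{G}$ with the pseudometric in which the distance of $(\mathbf{A}_1,\mathbf{G}_1)$ and $(\mathbf{A}_2,\mathbf{G}_2)$ is $\max\{\rho_{\mathcal B}(\mathbf{A}_1,\mathbf{A}_2),\rho_{\mathcal G}(\mathbf{G}_1,\mathbf{G}_2)\}$. Then the gadget construction $*:(\mathcal{B},\rho_{\mathcal B})\times(\mathcal{G},\rho_{\mathcal G})\to(\mathcal{R},\rho_{\mathcal R})$, $(\mathbf{A},\mathbf{G})\mapsto\mathbf{A}*\mathbf{G}$, is continuous.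
   Context: Fix a purely relational first-order language $L$ (with equality, all arities finite and positive) and a relation symbol $R\notin L$ of arity $\mathrm{ar}(R)\ge 1$. Structures are nonempty and of arbitrary cardinality; $V(\mathbf A)$ is the universe of $\mathbf A$. Base structures and gadgets. $L_R=L\cup\{R\}$; a base structure is an $L_R$-structure. $L_G$ is $L$ extended by constants $z_1,\dots,z_{\mathrm{ar}(R)}$; a gadget is an $L_G$-structure $\mathbf G$ in which the vertices $z_i^{\mathbf G}$ (the roots) are pairwise distinct. Gadget construction. For a base structure $\mathbf A$ and a gadget $\mathbf G$, $\mathbf A*\mathbf G$ is the $L$-structure with universe $\big(V(\mathbf A)\sqcup(R^{\mathbf A}\times V(\mathbf G))\big)/\!\sim$, where $\sim$ is the equivalence generated by $e_i\sim(\boldsymbol e,z_i^{\mathbf G})$ for $\boldsymbol e\in R^{\mathbf A}$, $i\in\{1,\dots,\mathrm{ar}(R)\}$. For $S\in L$ of arity $s$, $S^{\mathbf A*\mathbf G}=\{([a_1],\dots,[a_s]):(a_1,\dots,a_s)\in S^{\mathbf A}\}\cup\{([(\boldsymbol e,v_1)],\dots,[(\boldsymbol e,v_s)]):\boldsymbol e\in R^{\mathbf A},(v_1,\dots,v_s)\in S^{\mathbf G}\}$. Pseudometric. $\mathbf A\equiv_k\mathbf B$ means that $\mathbf A$ and $\mathbf B$ satisfy the same sentences of quantifier rank at most $k$. The elementary-equivalence pseudometric on the structures of a given language is $\rho(\mathbf A,\mathbf B)=\inf\{2^{ -k}:k\in\mathbb N,\ \mathbf A\equiv_k\mathbf B\}$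 (with $\inf\emptyset=1$). -}

module Defs where

open import Level using (Level; _⊔_) renaming (suc to lsuc)
open import Data.Nat.Base as ℕ using (ℕ; zero; suc)
import Data.Nat.Properties as ℕ
import Data.Integer.Base as ℤ
import Data.Integer.Properties as ℤ
open import Data.Rational.Base as ℚ using (ℚ; mkℚ; 0ℚ; 1ℚ; _/_; _<_; *<*)
import Data.Rational.Properties as ℚ
import Data.Rational.Unnormalised.Base as ℚᵘ
import Data.Rational.Unnormalised.Properties as ℚᵘ
open import Data.Fin.Base using (Fin)
open import Data.Maybe.Base using (Maybe; just; nothing; maybe′)
open import Data.Product.Base using (∃-syntax; Σ-syntax; _×_; _,_; proj₁)
open import Data.Sum.Base using (_⊎_; inj₁; inj₂)
open import Data.Empty.Polymorphic using (⊥)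
open import Data.Vec.Functional using (Vector; []; _∷_)
open import Function.Bundles using (_⇔_)
import Function.Properties.Equivalence as ⇔
open import Relation.Binary.Bundles using (Setoid)
import Relation.Binary.Construct.Closure.Equivalence as EqClosure
open import Relation.Binary.Definitions using (tri<; tri≈; tri>)
open import Relation.Binary.PropositionalEquality using (_≢_; refl; sym; cong; subst)
open import Relation.Nullary using (¬_)

------------------------------------------------------------------------
-- Languages and structures

record RelationalLanguage (l : Level) : Set (lsuc l) where
  field
    Symbol  : Set l
    arity   : Symbol → ℕ
    arity≥1 : ∀ S → 1 ℕ.≤ arity S

-- L ∪ {R} with R ∉ L of arity r: R is the symbol `nothing`.
adjoin : ∀ {l} → RelationalLanguage l → (r : ℕ) → 1 ℕ.≤ r → RelationalLanguage l
adjoin L r r≥1 = record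
  { Symbol  = Maybe Symbol
  ; arity   = maybe′ arity r
  ; arity≥1 = λ { (just S) → arity≥1 S ; nothing → r≥1 }
  }
  where open RelationalLanguage L

-- Structures for L extended by c constants.  The universe is a setoid whose
-- equality interprets the equality of the language, so that quotients of
-- universes exist.
record Structure {l} (L : RelationalLanguage l) (c : ℕ) (ℓ : Level) : Set (l ⊔ lsuc ℓ) where
  open RelationalLanguage L
  field
    universe : Setoid ℓ ℓ
  open Setoid universe public using (Carrier; _≈_)
    renaming (refl to ≈-refl; sym to ≈-sym; trans to ≈-trans)
  field
    nonempty : Carrier
    rel      : (S : Symbol) → Vector Carrier (arity S) → Set ℓ
    rel-resp : ∀ S {u v : Vector Carrier (arity S)} →
               (∀ i → u i ≈ v i) → rel S u → rel S v
    con      : Vector Carrier c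

------------------------------------------------------------------------
-- First-order logic

data Term (c n : ℕ) : Set where
  var : Fin n → Term c n
  con : Fin c → Term c n

infix  6 _≐_
infixr 5 _⇒_

-- Formulas with free variables in Fin n, over the complete set of
-- connectives ⊥, ⇒, ∀ (so ¬ φ is φ ⇒ ⊥, and ∃ is ¬ ∀ ¬).
data Formula {l} (L : RelationalLanguage l) (c : ℕ) : ℕ → Set l where
  _≐_  : ∀ {n} → Term c n → Term c n → Formula L c n
  atom : ∀ {n} (S : RelationalLanguage.Symbol L) →
         Vector (Term c n) (RelationalLanguage.arity L S) → Formula L c n
  ⊥′   : ∀ {n} → Formula L c n
  _⇒_  : ∀ {n} → Formula L c n → Formula L c n → Formula L c n
  ∀′   : ∀ {n} → Formula L c (suc n) → Formula L c n

Sentence : ∀ {l} → RelationalLanguage l → ℕ → Set l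
Sentence L c = Formula L c 0

qr : ∀ {l} {L : RelationalLanguage l} {c n} → Formula L c n → ℕ
qr (t ≐ u)    = 0
qr (atom S t) = 0
qr ⊥′         = 0
qr (φ ⇒ ψ)    = qr φ ℕ.⊔ qr ψ
qr (∀′ φ)     = suc (qr φ)

module _ {l ℓ : Level} {L : RelationalLanguage l} {c : ℕ} where

  module _ (A : Structure L c ℓ) where
    open Structure A

    ⟦_⟧ : ∀ {n} → Term c n → Vector Carrier n → Carrier
    ⟦ var i ⟧ σ = σ i
    ⟦ con i ⟧ σ = Structure.con A i

    -- Satisfaction in the sense of classical logic.  Double negation of the
    -- atomic cases makes satisfaction of every formula ¬¬-stable, hence all
    -- classical laws hold for it; under excluded middle this is Tarski's
    -- definition verbatim.
    Sat : ∀ {n} → Formula L c n → Vector Carrier n → Set ℓ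
    Sat (t ≐ u)    σ = ¬ ¬ (⟦ t ⟧ σ ≈ ⟦ u ⟧ σ)
    Sat (atom S t) σ = ¬ ¬ rel S (λ i → ⟦ t i ⟧ σ)
    Sat ⊥′         σ = ⊥
    Sat (φ ⇒ ψ)    σ = Sat φ σ → Sat ψ σ
    Sat (∀′ φ)     σ = ∀ a → Sat φ (a ∷ σ)

  infix 4 _⊨_ _≡[_]_

  _⊨_ : Structure L c ℓ → Sentence L c → Set ℓ
  A ⊨ φ = Sat A φ []

  _≡[_]_ : Structure L c ℓ → ℕ → Structure L c ℓ → Set (l ⊔ ℓ)
  A ≡[ k ] B = ∀ (φ : Sentence L c) → qr φ ℕ.≤ k → (A ⊨ φ) ⇔ (B ⊨ φ)

------------------------------------------------------------------------
-- Base structures, gadgets and the gadget construction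

BaseStructure : ∀ {l} (L : RelationalLanguage l) (r : ℕ) → 1 ℕ.≤ r → (ℓ : Level) → Set (l ⊔ lsuc ℓ)
BaseStructure L r r≥1 ℓ = Structure (adjoin L r r≥1) 0 ℓ

record Gadget {l} (L : RelationalLanguage l) (r : ℕ) (ℓ : Level) : Set (l ⊔ lsuc ℓ) where
  field
    structure : Structure L r ℓ
  open Structure structure public renaming (con to root)
  field
    roots-distinct : ∀ {i j} → i ≢ j → ¬ (root i ≈ root j)

module _ {l ℓ : Level} {L : RelationalLanguage l} {r : ℕ} {r≥1 : 1 ℕ.≤ r} where

  module _ (A : BaseStructure L r r≥1 ℓ) (G : Gadget L r ℓ) where
    open RelationalLanguage L
    private
      module A = Structure A
      module G = Gadget G

    REdge : Set ℓ
    REdge = Σ[ e ∈ Vector A.Carrier r ] A.rel nothing e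

    -- `base` and `copy` are the equality of the disjoint union
    -- V(A) ⊔ (R^A × V(G)); elements of R^A are compared as tuples,
    -- irrespective of the proof of membership.
    data Glue : A.Carrier ⊎ (REdge × G.Carrier) → A.Carrier ⊎ (REdge × G.Carrier) → Set ℓ where
      base : ∀ {a b} → a A.≈ b → Glue (inj₁ a) (inj₁ b)
      copy : ∀ {e f : REdge} {v w} → (∀ i → proj₁ e i A.≈ proj₁ f i) → v G.≈ w →
             Glue (inj₂ (e , v)) (inj₂ (f , w))
      glue : ∀ (e : REdge) i → Glue (inj₁ (proj₁ e i)) (inj₂ (e , G.root i))

    infixl 7 _*_

    _*_ : Structure L 0 ℓ
    _*_ = record
      { universe = universe
      ; nonempty = inj₁ A.nonempty
      ; rel      = λ S x →
          (Σ[ a ∈ Vector A.Carrier (arity S) ]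
             A.rel (just S) a × (∀ i → x i ≈ inj₁ (a i)))
          ⊎
          (Σ[ e ∈ REdge ] Σ[ v ∈ Vector G.Carrier (arity S) ]
             G.rel S v × (∀ i → x i ≈ inj₂ (e , v i)))
      ; rel-resp = λ
          { S x≈y (inj₁ (a , Sa , x≈a)) →
              inj₁ (a , Sa , λ i → ≈-trans (≈-sym (x≈y i)) (x≈a i))
          ; S x≈y (inj₂ (e , v , Sv , x≈v)) →
              inj₂ (e , v , Sv , λ i → ≈-trans (≈-sym (x≈y i)) (x≈v i))
          }
      ; con      = []
      }
      where
      universe = EqClosure.setoid Glue
      open Setoid universe using (_≈_) renaming (sym to ≈-sym; trans to ≈-trans)

------------------------------------------------------------------------
-- Upper reals

-- A real number given by the set of rationals strictly above it.  This is
-- the form in which infima of arbitrary sets exist constructively.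
record UpperReal (a : Level) : Set (lsuc a) where
  infix 4 _<ᵘ
  field
    _<ᵘ       : ℚ → Set a
    upward    : ∀ {p q} → p < q → p <ᵘ → q <ᵘ
    rounded   : ∀ {q} → q <ᵘ → ∃[ p ] p < q × p <ᵘ
    inhabited : ∃[ q ] q <ᵘ

infix 4 _≺_

_≺_ : ∀ {a} → UpperReal a → ℚ → Set a
x ≺ q = UpperReal._<ᵘ x q

-- The infimum of an inhabited family of rationals.
inf : ∀ {a} {I : Set a} → I → (I → ℚ) → UpperReal a
inf {I = I} i₀ f = record
  { _<ᵘ       = λ q → Σ[ i ∈ I ] f i < q
  ; upward    = λ { p<q (i , fi<p) → i , ℚ.<-trans fi<p p<q }
  ; rounded   = λ { (i , fi<q) → let m , fi<m , m<q = ℚ.<-dense fi<q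
                                 in m , m<q , i , fi<m }
  ; inhabited = f i₀ ℚ.+ 1ℚ , i₀ ,
                subst (_< f i₀ ℚ.+ 1ℚ) (ℚ.+-identityʳ (f i₀))
                  (ℚ.+-monoʳ-< (f i₀) (ℚ.positive⁻¹ 1ℚ))
  }

max : ∀ {a b} → UpperReal a → UpperReal b → UpperReal (a ⊔ b)
max x y = record
  { _<ᵘ       = λ q → x ≺ q × y ≺ q
  ; upward    = λ { p<q (x<p , y<p) → X.upward p<q x<p , Y.upward p<q y<p }
  ; rounded   = λ { (x<q , y<q) → common (X.rounded x<q) (Y.rounded y<q) }
  ; inhabited = above X.inhabited Y.inhabited
  }
  where
  module X = UpperReal x
  module Y = UpperReal y
  above : ∃[ p ] x ≺ p → ∃[ q ] y ≺ q → ∃[ s ] x ≺ s × y ≺ s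
  above (p , x<p) (q , y<q) with ℚ.<-cmp p q
  ... | tri< p<q _ _ = q , X.upward p<q x<p , y<q
  ... | tri≈ _ refl _ = p , x<p , y<q
  ... | tri> _ _ q<p = p , x<p , Y.upward q<p y<q
  common : ∀ {q} → ∃[ p ] p < q × x ≺ p → ∃[ p ] p < q × y ≺ p →
           ∃[ p ] p < q × x ≺ p × y ≺ p
  common (p , p<q , x<p) (p′ , p′<q , y<p′) with ℚ.<-cmp p p′
  ... | tri< p<p′ _ _ = p′ , p′<q , X.upward p<p′ x<p , y<p′
  ... | tri≈ _ refl _ = p , p<q , x<p , y<p′
  ... | tri> _ _ p′<p = p , p<q , x<p , Y.upward p′<p y<p′

------------------------------------------------------------------------
-- Pseudometric spaces

record PseudometricSpace (a b : Level) : Set (lsuc (a ⊔ b)) where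
  field
    Point    : Set a
    dist     : Point → Point → UpperReal b
    nonneg   : ∀ {x y q} → dist x y ≺ q → 0ℚ < q
    dist-xx  : ∀ {x q} → 0ℚ < q → dist x x ≺ q
    symm     : ∀ {x y q} → dist x y ≺ q → dist y x ≺ q
    triangle : ∀ {x y z p q} → dist x y ≺ p → dist y z ≺ q → dist x z ≺ p ℚ.+ q

open PseudometricSpace using (Point; dist)

infixr 2 _×ₘ_

_×ₘ_ : ∀ {a b a′ b′} → PseudometricSpace a b → PseudometricSpace a′ b′ →
       PseudometricSpace (a ⊔ a′) (b ⊔ b′)
X ×ₘ Y = record
  { Point    = X.Point × Y.Point
  ; dist     = λ { (x₁ , y₁) (x₂ , y₂) → max (X.dist x₁ x₂) (Y.dist y₁ y₂) }
  ; nonneg   = λ { (x , y) → X.nonneg x }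
  ; dist-xx  = λ 0<q → X.dist-xx 0<q , Y.dist-xx 0<q
  ; symm     = λ { (x , y) → X.symm x , Y.symm y }
  ; triangle = λ { (x , y) (x′ , y′) → X.triangle x x′ , Y.triangle y y′ }
  }
  where
  module X = PseudometricSpace X
  module Y = PseudometricSpace Y

Continuous : ∀ {a b a′ b′} (X : PseudometricSpace a b) (Y : PseudometricSpace a′ b′) →
             (Point X → Point Y) → Set (a ⊔ b ⊔ b′)
Continuous X Y f =
  ∀ x (ε : ℚ) → 0ℚ < ε →
  ∃[ δ ] 0ℚ < δ × (∀ y → dist X x y ≺ δ → dist Y (f x) (f y) ≺ ε)

------------------------------------------------------------------------
-- The elementary-equivalence pseudometric

2^-_ : ℕ → ℚ
2^- k = (ℤ.+ 1 / 2 ℕ.^ k) {{ℕ.m^n≢0 2 k}}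

-- The convention inf ∅ = 1 amounts to adjoining 1 (the index `nothing`) to
-- the set {2^-k : A ≡ₖ B}, all of whose elements are at most 1.
ρ : ∀ {l ℓ} {L : RelationalLanguage l} {c} →
    Structure L c ℓ → Structure L c ℓ → UpperReal (l ⊔ ℓ)
ρ A B = inf {I = Maybe (∃[ k ] A ≡[ k ] B)} nothing (maybe′ (λ (k , _) → 2^- k) 1ℚ)

1/d>0 : ∀ d .{{_ : ℕ.NonZero d}} → 0ℚ < ℤ.+ 1 / d
1/d>0 d = ℚ.positive⁻¹ (ℤ.+ 1 / d) {{ℚ.normalize-pos 1 d}}

2^->0 : ∀ k → 0ℚ < 2^- k
2^->0 k = 1/d>0 (2 ℕ.^ k) {{ℕ.m^n≢0 2 k}}

n<2^n : ∀ n → n ℕ.< 2 ℕ.^ n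
n<2^n zero    = ℕ.s≤s ℕ.z≤n
n<2^n (suc n) = ℕ.≤-trans (ℕ.+-mono-≤ (ℕ.m^n>0 2 n) (n<2^n n))
  (ℕ.≤-reflexive (cong (2 ℕ.^ n ℕ.+_) (sym (ℕ.+-identityʳ (2 ℕ.^ n)))))

1/d<q : ∀ d .{{_ : ℕ.NonZero d}} {q} → 0ℚ < q → ℚ.denominatorℕ q ℕ.< d → ℤ.+ 1 / d < q
1/d<q (suc d) {q@(mkℚ (ℤ.+ zero) m _)}  (*<* (ℤ.+<+ ())) m<d
1/d<q (suc d) {q@(mkℚ (ℤ.-[1+ n ]) m _)} (*<* ()) m<d
1/d<q (suc d) {q@(mkℚ (ℤ.+ suc n) m _)} 0<q m<d = ℚ.toℚᵘ-cancel-<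
  (ℚᵘ.<-respˡ-≃ (ℚᵘ.≃-sym (ℚ.toℚᵘ-fromℚᵘ (ℚᵘ.mkℚᵘ (ℤ.+ 1) d)))
    (ℚᵘ.*<* (ℤ.+<+ (ℕ.≤-trans (ℕ.s≤s (ℕ.≤-reflexive (ℕ.+-identityʳ (suc m))))
      (ℕ.≤-trans m<d (ℕ.m≤m+n (suc d) (n ℕ.* suc d)))))))

2^-<q : ∀ {q} → 0ℚ < q → ∃[ k ] 2^- k < q
2^-<q {q} 0<q = ℚ.denominatorℕ q ,
  1/d<q (2 ℕ.^ ℚ.denominatorℕ q) {{ℕ.m^n≢0 2 (ℚ.denominatorℕ q)}} 0<q (n<2^n _)

module _ {l ℓ : Level} {L : RelationalLanguage l} {c : ℕ} where

  ρ-nonneg : {A B : Structure L c ℓ} → ∀ {q} → ρ A B ≺ q → 0ℚ < q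
  ρ-nonneg (just (k , _) , <q) = ℚ.<-trans (2^->0 k) <q
  ρ-nonneg (nothing , <q)      = ℚ.<-trans (ℚ.positive⁻¹ 1ℚ) <q

  ρ-xx : {A : Structure L c ℓ} → ∀ {q} → 0ℚ < q → ρ A A ≺ q
  ρ-xx 0<q = let k , <q = 2^-<q 0<q in just (k , λ φ _ → ⇔.refl) , <q

  ρ-symm : {A B : Structure L c ℓ} → ∀ {q} → ρ A B ≺ q → ρ B A ≺ q
  ρ-symm (just (k , A≡B) , <q) = just (k , λ φ φ≤k → ⇔.sym (A≡B φ φ≤k)) , <q
  ρ-symm (nothing , <q)        = nothing , <q

  +-lemmaˡ : ∀ {s p q} → s < p → 0ℚ < q → s < p ℚ.+ q
  +-lemmaˡ {s} {p} {q} s<p 0<q =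
    subst (_< p ℚ.+ q) (ℚ.+-identityʳ s) (ℚ.+-mono-< s<p 0<q)

  +-lemmaʳ : ∀ {s p q} → 0ℚ < p → s < q → s < p ℚ.+ q
  +-lemmaʳ {s} {p} {q} 0<p s<q =
    subst (_< p ℚ.+ q) (ℚ.+-identityˡ s) (ℚ.+-mono-< 0<p s<q)

  ρ-triangle : {A B C : Structure L c ℓ} → ∀ {p q} → ρ A B ≺ p → ρ B C ≺ q → ρ A C ≺ p ℚ.+ q
  ρ-triangle {A} {B} {C} x@(nothing , 1<p) y =
    nothing , +-lemmaˡ 1<p (ρ-nonneg {B} {C} y)
  ρ-triangle {A} {B} {C} x@(just _ , _) y@(nothing , 1<q) =
    nothing , +-lemmaʳ (ρ-nonneg {A} {B} x) 1<q
  ρ-triangle {A} {B} {C} x@(just (j , A≡B) , <p) y@(just (k , B≡C) , <q)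
    with ℕ.≤-total j k
  ... | inj₁ j≤k = just (j , λ φ φ≤j → ⇔.trans (A≡B φ φ≤j) (B≡C φ (ℕ.≤-trans φ≤j j≤k)))
                 , +-lemmaˡ <p (ρ-nonneg {B} {C} y)
  ... | inj₂ k≤j = just (k , λ φ φ≤k → ⇔.trans (A≡B φ (ℕ.≤-trans φ≤k k≤j)) (B≡C φ φ≤k))
                 , +-lemmaʳ (ρ-nonneg {A} {B} x) <q

Structures : ∀ {l} → RelationalLanguage l → ℕ → (ℓ : Level) → PseudometricSpace (l ⊔ lsuc ℓ) (l ⊔ ℓ)
Structures L c ℓ = record
  { Point    = Structure L c ℓ
  ; dist     = ρ
  ; nonneg   = λ {A} {B} → ρ-nonneg {A = A} {B}
  ; dist-xx  = λ {A} → ρ-xx {A = A}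
  ; symm     = λ {A} {B} → ρ-symm {A = A} {B}
  ; triangle = λ {A} {B} {C} → ρ-triangle {A = A} {B} {C}
  }

𝓑 : ∀ {l} (L : RelationalLanguage l) (r : ℕ) → 1 ℕ.≤ r → (ℓ : Level) →
    PseudometricSpace (l ⊔ lsuc ℓ) (l ⊔ ℓ)
𝓑 L r r≥1 ℓ = Structures (adjoin L r r≥1) 0 ℓ

𝓖 : ∀ {l} (L : RelationalLanguage l) (r : ℕ) (ℓ : Level) →
    PseudometricSpace (l ⊔ lsuc ℓ) (l ⊔ ℓ)
𝓖 L r ℓ = record
  { Point    = Gadget L r ℓ
  ; dist     = λ G H → ρ (structure G) (structure H)
  ; nonneg   = λ {G} {H} → nonneg {structure G} {structure H}
  ; dist-xx  = λ {G} → dist-xx {structure G}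
  ; symm     = λ {G} {H} → symm {structure G} {structure H}
  ; triangle = λ {G} {H} {K} → triangle {structure G} {structure H} {structure K}
  }
  where
  open Gadget using (structure)
  open PseudometricSpace (Structures L r ℓ) using (nonneg; dist-xx; symm; triangle)

𝓡 : ∀ {l} (L : RelationalLanguage l) (ℓ : Level) → PseudometricSpace (l ⊔ lsuc ℓ) (l ⊔ ℓ)
𝓡 L ℓ = Structures L 0 ℓ

{-# OPTIONS --safe #-}
module Submission where

-- An Ehrenfeucht–Fraïssé argument.  A position of the game on A * G and B * H
-- consists of a position of the game on A and B, finitely many R-edges among
-- the vertices named in it, and for each of these edges a position of the game
-- on G and H.  A move in A * G either is a vertex of A, or lies in the copy of G
-- at some edge: the edge costs up to r moves on A and B, and the vertex one move
-- on G and H.  Deciding an atomic formula may need the edge whose copy holds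
-- the tuple, another r moves.  Hence A ≡ B up to rank (k + 1) r and G ≡ H up to
-- rank k give A * G ≡ B * H up to rank k.
--
-- The language may be infinite, but a single sentence uses only finitely many
-- symbols, and over these finitely many formulas of each rank suffice to play;
-- the bound on the rank does not depend on the symbols.

open import Level using (Level; _⊔_)
open import Data.Nat.Base as ℕ using (ℕ; zero; suc; _≤_; z≤n; s≤s)
import Data.Nat.Properties as ℕ
open import Data.Fin.Base using (Fin; zero; suc; fromℕ<)
open import Data.Fin.Properties using (∀-cons) renaming (_≟_ to _≟ᶠ_)
import Data.Integer.Base as ℤ
import Data.Integer.Properties as ℤ
open import Data.Rational.Base as ℚ using (_/_)
import Data.Rational.Properties as ℚ
import Data.Rational.Unnormalised.Base as ℚᵘ
import Data.Rational.Unnormalised.Properties as ℚᵘ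
open import Data.Maybe.Base using (just; nothing)
open import Data.Product.Base
  using (∃-syntax; Σ-syntax; _×_; _,_; proj₁; proj₂; uncurry)
open import Data.Sum.Base using (_⊎_; inj₁; inj₂)
open import Data.Empty using (⊥-elim)
import Data.Empty.Polymorphic as Polymorphic
open import Data.List.Base as List using (List; []; _∷_; _++_; concatMap; cartesianProductWith)
open import Data.List.Membership.Propositional using (_∈_; lose)
open import Data.List.Membership.Propositional.Properties
  using (∈-++⁺ˡ; ∈-++⁺ʳ; ∈-map⁺; ∈-concatMap⁺; ∈-cartesianProductWith⁺; ∈-allFin)
open import Data.List.Relation.Unary.All as All using (All; []; _∷_)
import Data.List.Relation.Unary.All.Properties as All
open import Data.List.Relation.Unary.Any using (here; there)
open import Data.Vec.Functional using (Vector) renaming ([] to []ᵛ; _∷_ to infixr 5 _∷ᵛ_)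
open import Function.Base using (_∘_; id)
open import Function.Bundles using (_⇔_; mk⇔; Equivalence)
import Function.Properties.Equivalence as ⇔
open import Relation.Binary.Construct.Closure.ReflexiveTransitive using (ε; _◅_)
open import Relation.Binary.Construct.Closure.Symmetric using (fwd; bwd)
open import Relation.Binary.PropositionalEquality using (_≡_; refl; cong; setoid)
open import Relation.Nullary using (¬_; yes; no; contradiction)
open import Relation.Nullary.Decidable using (¬¬-excluded-middle)
open import Relation.Nullary.Negation using (negated-stable)
open import Defs

private
  variable
    a b l ℓ : Level
    n : ℕ

-- Double negation as a monad, and finite enumerations

pure : {P : Set a} → P → ¬ ¬ P
pure x ¬x = ¬x x

_>>=_ : {P : Set a} {Q : Set b} → ¬ ¬ P → (P → ¬ ¬ Q) → ¬ ¬ Q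
(m >>= f) ¬q = m λ x → f x ¬q

-- Finiteness of the index matters: over an arbitrary type this is double-negation shift, which is
-- not constructively provable.
¬¬-sequence : ∀ {n} {P : Fin n → Set a} → (∀ i → ¬ ¬ P i) → ¬ ¬ (∀ i → P i)
¬¬-sequence {n = zero}  m = pure λ ()
¬¬-sequence {n = suc n} m = do
  x  ← m zero
  xs ← ¬¬-sequence (m ∘ suc)
  pure (∀-cons x xs)

vectors : {X : Set a} → List X → ∀ n → List (Vector X n)
vectors xs zero    = []ᵛ ∷ []
vectors xs (suc n) = cartesianProductWith _∷ᵛ_ xs (vectors xs n)

-- Without function extensionality, completeness of the enumeration holds only
-- up to pointwise equality.
∈-vectors : ∀ {X : Set a} {xs : List X} (t : Vector X n) → (∀ i → t i ∈ xs) →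
            ∃[ u ] u ∈ vectors xs n × (∀ i → u i ≡ t i)
∈-vectors {n = zero}  t t∈ = []ᵛ , here refl , λ ()
∈-vectors {n = suc n} t t∈ with ∈-vectors (t ∘ suc) (t∈ ∘ suc)
... | u , u∈ , u≗t = t zero ∷ᵛ u , ∈-cartesianProductWith⁺ _∷ᵛ_ (t∈ zero) u∈ ,
                     ∀-cons refl u≗t

terms : ∀ c n → List (Term c n)
terms c n = List.map var (List.allFin n) ++ List.map con (List.allFin c)

∈-terms : ∀ {c} (t : Term c n) → t ∈ terms c n
∈-terms (var i) = ∈-++⁺ˡ (∈-map⁺ var (∈-allFin i))
∈-terms {n} (con i) = ∈-++⁺ʳ (List.map var (List.allFin n)) (∈-map⁺ con (∈-allFin i))

-- Finite sets of formulas and their truth values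

module _ {L : RelationalLanguage l} {c : ℕ} where
  open RelationalLanguage L

  symbols : Formula L c n → List Symbol
  symbols (t ≐ u)    = []
  symbols (atom S t) = S ∷ []
  symbols ⊥′         = []
  symbols (φ ⇒ ψ)    = symbols φ ++ symbols ψ
  symbols (∀′ φ)     = symbols φ

  -- The exit from the double-negation monad: classical arguments about a formula end in genuine
  -- satisfaction.
  Sat-stable : (A : Structure L c ℓ) (φ : Formula L c n) {σ : Vector (Structure.Carrier A) n} →
               ¬ ¬ Sat A φ σ → Sat A φ σ
  Sat-stable A (t ≐ u)    m   = negated-stable m
  Sat-stable A (atom S t) m   = negated-stable m
  Sat-stable A ⊥′         m   = ⊥-elim (m λ ())
  Sat-stable A (φ ⇒ ψ)    m s = Sat-stable A ψ (m >>= λ f → pure (f s))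
  Sat-stable A (∀′ φ)     m x = Sat-stable A φ (m >>= λ f → pure (f x))

  Agree : List (Formula L c n) →
          (A : Structure L c ℓ) → Vector (Structure.Carrier A) n →
          (B : Structure L c ℓ) → Vector (Structure.Carrier B) n → Set (l ⊔ ℓ)
  Agree Γ A α B β = All (λ γ → Sat A γ α ⇔ Sat B γ β) Γ

  -- Negations of the complete descriptions of truth values on Γ, which in the
  -- connectives ⊥ and ⇒ are simpler than the descriptions themselves.
  refutations : List (Formula L c n) → List (Formula L c n)
  refutations []      = ⊥′ ∷ []
  refutations (γ ∷ Γ) = List.map (γ ⇒_) (refutations Γ) ++
                        List.map ((γ ⇒ ⊥′) ⇒_) (refutations Γ)

  -- Excluded middle, available under the double negation, picks the true literal for each `γ`. The
  -- resulting `δ` is the chain of these literals implying `⊥′`, so to fail `δ` at `β` is to satisfy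
  -- the same literals there.
  description : (Γ : List (Formula L c n)) (A : Structure L c ℓ) (α : Vector (Structure.Carrier A) n) →
                (B : Structure L c ℓ) →
                ¬ ¬ (∃[ δ ] δ ∈ refutations Γ × ¬ Sat A δ α ×
                     (∀ β → ¬ Sat B δ β → Agree Γ A α B β))
  description []      A α B = pure (⊥′ , here refl , (λ ()) , λ _ _ → [])
  description (γ ∷ Γ) A α B = do
    δ , δ∈ , A⊭δ , agree ← description Γ A α B
    yes A⊨γ ← ¬¬-excluded-middle {A = Sat A γ α}
      where
      no A⊭γ → pure
        ( (γ ⇒ ⊥′) ⇒ δ
        , ∈-++⁺ʳ (List.map (γ ⇒_) (refutations Γ)) (∈-map⁺ _ δ∈)
        , (λ f → A⊭δ (f λ s → contradiction s A⊭γ))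
        , λ β B⊭ → mk⇔ (λ s → contradiction s A⊭γ)
                       (λ s → ⊥-elim (B⊭ λ f → Polymorphic.⊥-elim (f s)))
                 ∷ agree β (λ s → B⊭ λ _ → s)
        )
    pure
      ( γ ⇒ δ
      , ∈-++⁺ˡ (∈-map⁺ _ δ∈)
      , (λ f → A⊭δ (f A⊨γ))
      , λ β B⊭ → mk⇔ (λ _ → Sat-stable B γ λ ¬s → B⊭ λ s → contradiction s ¬s)
                     (λ _ → A⊨γ)
               ∷ agree β (λ s → B⊭ λ _ → s)
      )

  refutations-qr : ∀ {k} {Γ : List (Formula L c n)} → All (λ γ → qr γ ≤ k) Γ →
                   All (λ γ → qr γ ≤ k) (refutations Γ)
  refutations-qr []       = z≤n ∷ []
  refutations-qr (p ∷ ps) = All.++⁺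
    (All.map⁺ (All.map (ℕ.⊔-lub p) (refutations-qr ps)))
    (All.map⁺ (All.map (ℕ.⊔-lub (ℕ.⊔-lub p z≤n)) (refutations-qr ps)))

-- Ehrenfeucht–Fraïssé equivalence over finitely many relation symbols

module EF {L : RelationalLanguage l} (c : ℕ) (Ss : List (RelationalLanguage.Symbol L)) where
  open RelationalLanguage L

  equations : ∀ n → List (Formula L c n)
  equations n = cartesianProductWith _≐_ (terms c n) (terms c n)

  atoms : ∀ n → Symbol → List (Formula L c n)
  atoms n S = List.map (atom S) (vectors (terms c n) (arity S))

  -- Hintikka formulas in negated form: for a refutation `δ`, the failure of `∀′ δ` says that some
  -- vertex extends the tuple to one with the truth values that `δ` rules out.
  typeFormulas : ℕ → ∀ n → List (Formula L c n)
  typeFormulas zero    n = equations n ++ concatMap (atoms n) Ss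
  typeFormulas (suc k) n = typeFormulas k n ++ List.map ∀′ (refutations (typeFormulas k (suc n)))

  typeFormulas-qr : ∀ k n → All (λ γ → qr γ ≤ k) (typeFormulas k n)
  typeFormulas-qr zero n = All.++⁺
    (All.cartesianProductWith⁺ (setoid _) (setoid _) _≐_ (terms c n) (terms c n) λ _ _ → z≤n)
    (All.concat⁺ (All.map⁺ (All.universal (λ S → All.map⁺ (All.universal (λ _ → z≤n) _)) Ss)))
  typeFormulas-qr (suc k) n = All.++⁺
    (All.map ℕ.m≤n⇒m≤1+n (typeFormulas-qr k n))
    (All.map⁺ (All.map s≤s (refutations-qr (typeFormulas-qr k (suc n)))))

  module _ {ℓ : Level} where

    record Equivalent (k : ℕ) (A : Structure L c ℓ) (α : Vector (Structure.Carrier A) n)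
                      (B : Structure L c ℓ) (β : Vector (Structure.Carrier B) n) : Set (l ⊔ ℓ) where
      constructor equivalent
      field agree : Agree (typeFormulas k n) A α B β

    module _ {A B : Structure L c ℓ} where
      private
        module A = Structure A
        module B = Structure B

      ≡⇒Equivalent : ∀ {k} → A ≡[ k ] B → Equivalent k A []ᵛ B []ᵛ
      ≡⇒Equivalent A≡B = equivalent (All.map (A≡B _) (typeFormulas-qr _ 0))

      module _ {n} {α : Vector A.Carrier n} {β : Vector B.Carrier n} where

        Equivalent-sym : ∀ {k} → Equivalent k A α B β → Equivalent k B β A α
        Equivalent-sym (equivalent agree) = equivalent (All.map ⇔.sym agree)

        weaken : ∀ m {k} → Equivalent (m ℕ.+ k) A α B β → Equivalent k A α B β
        weaken zero    α~β = α~β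
        weaken (suc m) {k} (equivalent agree) =
          weaken m (equivalent (All.++⁻ˡ (typeFormulas (m ℕ.+ k) n) agree))

        weaken-0 : ∀ k → Equivalent k A α B β → Equivalent 0 A α B β
        weaken-0 zero    α~β = α~β
        weaken-0 (suc k) α~β = weaken-0 k (weaken 1 α~β)

        -- If no `y` were suitable, the refutation `δ` failing at `x` would hold at all `y`; then
        -- `∀′ δ` would hold at `β`, hence at `α`, and `δ` at `x`.
        extend : ∀ {k} → Equivalent (suc k) A α B β → ∀ x →
                 ¬ ¬ (∃[ y ] Equivalent k A (x ∷ᵛ α) B (y ∷ᵛ β))
        extend {k} (equivalent α~β) x ¬∃ = description (typeFormulas k (suc n)) A (x ∷ᵛ α) B
          λ (δ , δ∈ , A⊭δ , agree) →
            A⊭δ (Equivalence.from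
              (All.lookup (All.++⁻ʳ (typeFormulas k n) α~β) (∈-map⁺ ∀′ δ∈))
              (λ y → Sat-stable B δ λ B⊭δ → ¬∃ (y , equivalent (agree (y ∷ᵛ β) B⊭δ)))
              x)

    -- Naming by a common term, rather than a common variable, makes the gadget roots, which are
    -- constants, correspond without any move.
    record Linked (A : Structure L c ℓ) (α : Vector (Structure.Carrier A) n)
                  (B : Structure L c ℓ) (β : Vector (Structure.Carrier B) n)
                  (x : Structure.Carrier A) (y : Structure.Carrier B) : Set ℓ where
      constructor link
      field
        term  : Term c n
        nameˡ : Structure._≈_ A (⟦_⟧ A term α) x
        nameʳ : Structure._≈_ B (⟦_⟧ B term β) y

    module _ {A B : Structure L c ℓ} where
      private
        module A = Structure A
        module B = Structure B

      module _ {n} {α : Vector A.Carrier n} {β : Vector B.Carrier n} where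

        Linked-sym : ∀ {x y} → Linked A α B β x y → Linked B β A α y x
        Linked-sym (link t p q) = link t q p

        Linked-respˡ : ∀ {x x′ y} → x A.≈ x′ → Linked A α B β x y → Linked A α B β x′ y
        Linked-respˡ x≈x′ (link t p q) = link t (A.≈-trans p x≈x′) q

        Linked-con : ∀ i → Linked A α B β (A.con i) (B.con i)
        Linked-con i = link (con i) A.≈-refl B.≈-refl

        Linked-here : ∀ {x y} → Linked A (x ∷ᵛ α) B (y ∷ᵛ β) x y
        Linked-here = link (var zero) A.≈-refl B.≈-refl

        Linked-there : ∀ {x y x′ y′} → Linked A α B β x y → Linked A (x′ ∷ᵛ α) B (y′ ∷ᵛ β) x y
        Linked-there (link (var i) p q) = link (var (suc i)) p q
        Linked-there (link (con i) p q) = link (con i) p q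

        Linked-≈ : ∀ {k x x′ y y′} → Equivalent k A α B β →
                   Linked A α B β x y → Linked A α B β x′ y′ → x A.≈ x′ → ¬ ¬ (y B.≈ y′)
        Linked-≈ {k} α~β (link t p q) (link t′ p′ q′) x≈x′ = do
          t≈t′ ← Equivalence.to
            (All.lookup (All.++⁻ˡ (equations n) (Equivalent.agree (weaken-0 k α~β)))
              (∈-cartesianProductWith⁺ _≐_ (∈-terms t) (∈-terms t′)))
            (pure (A.≈-trans p (A.≈-trans x≈x′ (A.≈-sym p′))))
          pure (B.≈-trans (B.≈-sym q) (B.≈-trans t≈t′ q′))

        Linked-rel : ∀ {k S} {x : Vector A.Carrier (arity S)} {y : Vector B.Carrier (arity S)} →
                     Equivalent k A α B β → S ∈ Ss → (∀ i → Linked A α B β (x i) (y i)) →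
                     A.rel S x → ¬ ¬ B.rel S y
        Linked-rel {k} {S} α~β S∈ xy Sx with ∈-vectors (λ i → Linked.term (xy i)) (λ i → ∈-terms _)
        ... | u , u∈ , u≡ = do
          Su ← Equivalence.to
            (All.lookup (All.++⁻ʳ (equations n) (Equivalent.agree (weaken-0 k α~β)))
              (∈-concatMap⁺ (atoms n) (lose S∈ (∈-map⁺ (atom S) u∈))))
            (pure (A.rel-resp S (λ i → A.≈-trans (A.≈-sym (Linked.nameˡ (xy i))) (≡⇒≈ i)) Sx))
          pure (B.rel-resp S (λ i → B.≈-trans (≡⇒≈′ i) (Linked.nameʳ (xy i))) Su)
          where
          ≡⇒≈ : ∀ i → ⟦_⟧ A (Linked.term (xy i)) α A.≈ ⟦_⟧ A (u i) α
          ≡⇒≈ i rewrite u≡ i = A.≈-refl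
          ≡⇒≈′ : ∀ i → ⟦_⟧ B (u i) β B.≈ ⟦_⟧ B (Linked.term (xy i)) β
          ≡⇒≈′ i rewrite u≡ i = B.≈-refl

      extend-vector : ∀ m {k n} {α : Vector A.Carrier n} {β : Vector B.Carrier n} →
        Equivalent (m ℕ.+ k) A α B β → (x : Vector A.Carrier m) →
        ¬ ¬ (Σ[ n′ ∈ ℕ ] Σ[ α′ ∈ Vector A.Carrier n′ ] Σ[ β′ ∈ Vector B.Carrier n′ ]
             Σ[ y ∈ Vector B.Carrier m ] Equivalent k A α′ B β′ × (∀ i → Linked A α′ B β′ (x i) (y i)) ×
             (∀ v w → Linked A α B β v w → Linked A α′ B β′ v w))
      extend-vector zero    α~β x = pure (_ , _ , _ , []ᵛ , α~β , (λ ()) , λ _ _ v~w → v~w)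
      extend-vector (suc m) α~β x = do
        y , xα~yβ ← extend α~β (x zero)
        _ , _ , _ , ys , α′~β′ , linked , keep ← extend-vector m xα~yβ (x ∘ suc)
        pure (_ , _ , _ , y ∷ᵛ ys , α′~β′ , ∀-cons (keep _ _ Linked-here) linked ,
              λ v w v~w → keep v w (Linked-there v~w))


-- Equality of vertices in `A * G`

module _ {L : RelationalLanguage l} {r : ℕ} {r≥1 : 1 ≤ r}
         {A : BaseStructure L r r≥1 ℓ} {G : Gadget L r ℓ} where
  private
    module A  = Structure A
    module G  = Gadget G
    module AG = Structure (A * G)

  root-injective : ∀ {i j} → G.root i G.≈ G.root j → i ≡ j
  root-injective {i} {j} zᵢ≈zⱼ with i ≟ᶠ j
  ... | yes i≡j = i≡j
  ... | no  i≢j = contradiction zᵢ≈zⱼ (G.roots-distinct i≢j)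

  copy-cong : ∀ {e f : REdge A G} {v w} → (∀ i → proj₁ e i A.≈ proj₁ f i) → v G.≈ w →
              inj₂ (e , v) AG.≈ inj₂ (f , w)
  copy-cong e≈f v≈w = fwd (copy e≈f v≈w) ◅ ε

  base-cong : ∀ {a b} → a A.≈ b → inj₁ a AG.≈ inj₁ b
  base-cong a≈b = fwd (base a≈b) ◅ ε

  glued : ∀ (e : REdge A G) i {v} → v G.≈ G.root i → inj₂ (e , v) AG.≈ inj₁ (proj₁ e i)
  glued e i v≈z = fwd (copy (λ _ → A.≈-refl) v≈z) ◅ bwd (glue e i) ◅ ε

  -- An explicit form of the equivalence class of `inj₁ a`, so that the generated equality can be
  -- analysed one step of a path at a time.
  IsBase : A.Carrier → AG.Carrier → Set ℓ
  IsBase a (inj₁ b)       = a A.≈ b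
  IsBase a (inj₂ (e , v)) = ∃[ i ] a A.≈ proj₁ e i × v G.≈ G.root i

  IsBase-resp : ∀ {a x y} → x AG.≈ y → IsBase a x → IsBase a y
  IsBase-resp ε p = p
  IsBase-resp (fwd (base a≈b) ◅ ss)     p = IsBase-resp ss (A.≈-trans p a≈b)
  IsBase-resp (bwd (base a≈b) ◅ ss)     p = IsBase-resp ss (A.≈-trans p (A.≈-sym a≈b))
  IsBase-resp (fwd (copy e≈f v≈w) ◅ ss) (i , p , q) =
    IsBase-resp ss (i , A.≈-trans p (e≈f i) , G.≈-trans (G.≈-sym v≈w) q)
  IsBase-resp (bwd (copy e≈f v≈w) ◅ ss) (i , p , q) =
    IsBase-resp ss (i , A.≈-trans p (A.≈-sym (e≈f i)) , G.≈-trans v≈w q)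
  IsBase-resp (fwd (glue e i) ◅ ss)     p = IsBase-resp ss (i , p , G.≈-refl)
  -- Distinctness of the roots enters here: a vertex that is root `j` and leaves its copy as root
  -- `i` has `i ≡ j`, so it returns to the entry equal to `a`.
  IsBase-resp (bwd (glue e i) ◅ ss)     (j , p , q) with root-injective q
  ... | refl = IsBase-resp ss p

  -- Says nothing about x if v is a root, where IsBase takes over.
  InCopy : REdge A G → G.Carrier → AG.Carrier → Set ℓ
  InCopy e v (inj₁ _)       = ∃[ i ] v G.≈ G.root i
  InCopy e v (inj₂ (f , w)) = ((∀ i → proj₁ e i A.≈ proj₁ f i) × v G.≈ w) ⊎ ∃[ i ] v G.≈ G.root i

  root⇒InCopy : ∀ {e v} x → ∃[ i ] v G.≈ G.root i → InCopy e v x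
  root⇒InCopy (inj₁ _) v≈z = v≈z
  root⇒InCopy (inj₂ _) v≈z = inj₂ v≈z

  -- As long as `v` is not seen to be a root, the path has only `copy` steps, which preserve edge
  -- and gadget vertex. A `glue` step shows that `v` is a root, and then nothing is left to track.
  InCopy-resp : ∀ {e v x y} → x AG.≈ y → InCopy e v x → InCopy e v y
  InCopy-resp ε p = p
  InCopy-resp {x = inj₁ _} (_ ◅ ss)      p        = InCopy-resp ss (root⇒InCopy _ p)
  InCopy-resp {x = inj₂ _} (_ ◅ ss)      (inj₂ p) = InCopy-resp ss (root⇒InCopy _ p)
  InCopy-resp (fwd (copy e≈f v≈w) ◅ ss) (inj₁ (p , q)) = InCopy-resp ss
    (inj₁ ((λ i → A.≈-trans (p i) (e≈f i)) , G.≈-trans q v≈w))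
  InCopy-resp (bwd (copy e≈f v≈w) ◅ ss) (inj₁ (p , q)) = InCopy-resp ss
    (inj₁ ((λ i → A.≈-trans (p i) (A.≈-sym (e≈f i))) , G.≈-trans q (G.≈-sym v≈w)))
  InCopy-resp (bwd (glue e i) ◅ ss)     (inj₁ (p , q)) = InCopy-resp ss (i , q)

-- The game on A * G and B * H

module Game {L : RelationalLanguage l} {r : ℕ} (r≥1 : 1 ≤ r) (ℓ : Level)
            (Ss : List (RelationalLanguage.Symbol L)) where
  open RelationalLanguage L
  open Gadget using (structure)

  private
    -- `nothing` is R itself: listing it forces the answer to an R-edge to be an R-edge.
    module EFᴮ = EF {L = adjoin L r r≥1} 0 (nothing ∷ List.map just Ss)
    module EFᴳ = EF {L = L} r Ss

    Base = BaseStructure L r r≥1 ℓ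

  -- `p` and `q` are the ranks left in the base and in the gadgets. Listing each edge once gives
  -- each copy a single gadget position; `G~H` is the start for copies opened later.
  record Position (A : Base) (G : Gadget L r ℓ) (B : Base) (H : Gadget L r ℓ)
                  (p q : ℕ) : Set (l ⊔ ℓ) where
    private
      module A = Structure A
      module B = Structure B
      module G = Gadget G
      module H = Gadget H
    field
      {size}      : ℕ
      α           : Vector A.Carrier size
      β           : Vector B.Carrier size
      α~β         : EFᴮ.Equivalent p A α B β
      {copies}    : ℕ
      e           : Fin copies → REdge A G
      f           : Fin copies → REdge B H
      e~f         : ∀ j i → EFᴮ.Linked A α B β (proj₁ (e j) i) (proj₁ (f j) i)
      e-injective : ∀ {i j} → (∀ k → proj₁ (e i) k A.≈ proj₁ (e j) k) → i ≡ j
      f-injective : ∀ {i j} → (∀ k → proj₁ (f i) k B.≈ proj₁ (f j) k) → i ≡ j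
      {sizes}     : Fin copies → ℕ
      γ           : ∀ j → Vector G.Carrier (sizes j)
      δ           : ∀ j → Vector H.Carrier (sizes j)
      γ~δ         : ∀ j → EFᴳ.Equivalent q (structure G) (γ j) (structure H) (δ j)
      G~H         : EFᴳ.Equivalent q (structure G) []ᵛ (structure H) []ᵛ

    -- A root may be matched either way; `Match-base` and `Match-copy` translate between the two.
    data Match (x : Structure.Carrier (A * G)) (y : Structure.Carrier (B * H)) : Set ℓ where
      inBase : ∀ {a b} → Structure._≈_ (A * G) x (inj₁ a) → Structure._≈_ (B * H) y (inj₁ b) →
               EFᴮ.Linked A α B β a b → Match x y
      inCopy : ∀ j {v w} →
               Structure._≈_ (A * G) x (inj₂ (e j , v)) → Structure._≈_ (B * H) y (inj₂ (f j , w)) →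
               EFᴳ.Linked (structure G) (γ j) (structure H) (δ j) v w → Match x y

  open Position

  flip : ∀ {A G B H p q} → Position A G B H p q → Position B H A G p q
  flip P = record
    { α           = β P
    ; β           = α P
    ; α~β         = EFᴮ.Equivalent-sym (α~β P)
    ; e           = f P
    ; f           = e P
    ; e~f         = λ j i → EFᴮ.Linked-sym (e~f P j i)
    ; e-injective = f-injective P
    ; f-injective = e-injective P
    ; γ           = δ P
    ; δ           = γ P
    ; γ~δ         = λ j → EFᴳ.Equivalent-sym (γ~δ P j)
    ; G~H         = EFᴳ.Equivalent-sym (G~H P)
    }

  Match-flip : ∀ {A G B H p q} (P : Position A G B H p q) {x y} →
               Match P x y → Match (flip P) y x
  Match-flip P (inBase x≈ y≈ a~b)   = inBase y≈ x≈ (EFᴮ.Linked-sym a~b)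
  Match-flip P (inCopy j x≈ y≈ v~w) = inCopy j y≈ x≈ (EFᴳ.Linked-sym v~w)

  module _ {A : Base} {G : Gadget L r ℓ} {B : Base} {H : Gadget L r ℓ} where
    private
      module A  = Structure A
      module B  = Structure B
      module G  = Gadget G
      module H  = Gadget H
      module AG = Structure (A * G)
      module BH = Structure (B * H)

    module _ {p q} (P : Position A G B H p q) where

      -- A copy vertex equal to a base vertex is a root. Roots are constants of the gadget language,
      -- so the answer is the same root, glued to the linked entry of `f P j`.
      Match-base : ∀ {x y a} → Match P x y → x AG.≈ inj₁ a →
                   ¬ ¬ (∃[ b ] EFᴮ.Linked A (α P) B (β P) a b × y BH.≈ inj₁ b)
      Match-base (inBase x≈a′ y≈b′ a′~b′) x≈a = pure
        (_ , EFᴮ.Linked-respˡ (IsBase-resp (AG.≈-trans (AG.≈-sym x≈a′) x≈a) A.≈-refl) a′~b′ , y≈b′)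
      Match-base (inCopy j x≈v y≈w v~w) x≈a
        with IsBase-resp (AG.≈-trans (AG.≈-sym x≈a) x≈v) A.≈-refl
      ... | i , a≈eᵢ , v≈z = do
        w≈z ← EFᴳ.Linked-≈ (γ~δ P j) v~w (EFᴳ.Linked-con i) v≈z
        pure (_ , EFᴮ.Linked-respˡ (A.≈-sym a≈eᵢ) (e~f P j i) , BH.≈-trans y≈w (glued (f P j) i w≈z))

      private
        LinkedAt : ∀ j → G.Carrier → H.Carrier → Set ℓ
        LinkedAt j = EFᴳ.Linked (structure G) (γ P j) (structure H) (δ P j)

      Match-root : ∀ {x y j v i} → Match P x y → x AG.≈ inj₂ (e P j , v) → v G.≈ G.root i →
                   ¬ ¬ (∃[ w ] LinkedAt j v w × y BH.≈ inj₂ (f P j , w))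
      Match-root {j = j} {i = i} x~y x≈v v≈z = do
        b , eᵢ~b , y≈b ← Match-base x~y (AG.≈-trans x≈v (glued (e P j) i v≈z))
        b≈fᵢ ← EFᴮ.Linked-≈ (α~β P) eᵢ~b (e~f P j i) A.≈-refl
        pure ( H.root i , EFᴳ.Linked-respˡ (G.≈-sym v≈z) (EFᴳ.Linked-con i)
             , BH.≈-trans y≈b (BH.≈-trans (base-cong b≈fᵢ) (BH.≈-sym (glued (f P j) i H.≈-refl))))

      -- A vertex of this copy either is a root or lies in no other copy; in the latter case
      -- `e-injective` identifies the copy of the match.
      Match-copy : ∀ {x y j v} → Match P x y → x AG.≈ inj₂ (e P j , v) →
                   ¬ ¬ (∃[ w ] LinkedAt j v w × y BH.≈ inj₂ (f P j , w))
      Match-copy x~y@(inBase x≈a _ _) x≈v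
        with IsBase-resp (AG.≈-trans (AG.≈-sym x≈a) x≈v) A.≈-refl
      ... | i , _ , v≈z = Match-root x~y x≈v v≈z
      Match-copy {j = j} {v} x~y@(inCopy j′ x≈v′ y≈w′ v′~w′) x≈v
        with InCopy-resp {e = e P j} {v} (AG.≈-trans (AG.≈-sym x≈v) x≈v′)
               (inj₁ ((λ _ → A.≈-refl) , G.≈-refl))
      ... | inj₂ (i , v≈z) = Match-root x~y x≈v v≈z
      ... | inj₁ (e≈e′ , v≈v′) with e-injective P e≈e′
      ...   | refl = pure (_ , EFᴳ.Linked-respˡ (G.≈-sym v≈v′) v′~w′ , y≈w′)

      -- The first match is brought into the form of the second; then equality transfers within a
      -- single type.
      Match-≈ : ∀ {x y x′ y′} → Match P x y → Match P x′ y′ → x AG.≈ x′ → ¬ ¬ (y BH.≈ y′)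
      Match-≈ x~y (inBase x′≈a y′≈b a~b) x≈x′ = do
        b′ , a~b′ , y≈b′ ← Match-base x~y (AG.≈-trans x≈x′ x′≈a)
        b′≈b ← EFᴮ.Linked-≈ (α~β P) a~b′ a~b A.≈-refl
        pure (BH.≈-trans y≈b′ (BH.≈-trans (base-cong b′≈b) (BH.≈-sym y′≈b)))
      Match-≈ x~y (inCopy j x′≈v y′≈w v~w) x≈x′ = do
        w′ , v~w′ , y≈w′ ← Match-copy x~y (AG.≈-trans x≈x′ x′≈v)
        w′≈w ← EFᴳ.Linked-≈ (γ~δ P j) v~w′ v~w G.≈-refl
        pure (BH.≈-trans y≈w′ (BH.≈-trans (copy-cong (λ _ → B.≈-refl) w′≈w) (BH.≈-sym y′≈w)))

    infix 4 _⊑_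

    _⊑_ : ∀ {p q p′ q′} → Position A G B H p q → Position A G B H p′ q′ → Set ℓ
    P ⊑ Q = ∀ x y → Match P x y → Match Q x y

    -- A new edge must differ from the edges already in play, since the vertices
    -- chosen in one copy have to be compared in a single gadget type.
    add-edge : ∀ {p q} (P : Position A G B H (r ℕ.+ p) q) (d : REdge A G) →
      ¬ ¬ (Σ[ Q ∈ Position A G B H p q ] P ⊑ Q × ∃[ j ] (∀ i → proj₁ d i A.≈ proj₁ (e Q j) i))
    add-edge P d = do
      no new ← ¬¬-excluded-middle {A = ∃[ j ] (∀ i → proj₁ d i A.≈ proj₁ (e P j) i)}
        where
        yes (j , d≈e) → pure
          ( record
            { α = α P ; β = β P ; α~β = EFᴮ.weaken r (α~β P)
            ; e = e P ; f = f P ; e~f = e~f P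
            ; e-injective = e-injective P ; f-injective = f-injective P
            ; γ = γ P ; δ = δ P ; γ~δ = γ~δ P ; G~H = G~H P
            }
          , (λ { _ _ (inBase x≈ y≈ a~b)   → inBase x≈ y≈ a~b
               ; _ _ (inCopy j x≈ y≈ v~w) → inCopy j x≈ y≈ v~w
               })
          , j , d≈e)
      _ , α′ , β′ , c , α′~β′ , d~c , keep ← EFᴮ.extend-vector r (α~β P) (proj₁ d)
      Rc ← EFᴮ.Linked-rel α′~β′ (here refl) d~c (proj₂ d)
      -- Were the answer an old edge, its equality with `f P j` would transfer back and make `d`
      -- old. This secures `f-injective`.
      let new′ : ¬ (∃[ j ] (∀ i → c i B.≈ proj₁ (f P j) i))
          new′ (j , c≈f) = ¬¬-sequence
            (λ i → EFᴮ.Linked-≈ (EFᴮ.Equivalent-sym α′~β′)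
                     (EFᴮ.Linked-sym (d~c i)) (EFᴮ.Linked-sym (keep _ _ (e~f P j i))) (c≈f i))
            λ d≈e → new (j , d≈e)
      pure
        ( record
          { α           = α′
          ; β           = β′
          ; α~β         = α′~β′
          ; e           = d ∷ᵛ e P
          ; f           = (c , Rc) ∷ᵛ f P
          ; e~f         = ∀-cons d~c λ j i → keep _ _ (e~f P j i)
          ; e-injective = λ
              { {zero}  {zero}  _   → refl
              ; {zero}  {suc j} d≈e → contradiction (j , d≈e) new
              ; {suc i} {zero}  e≈d → contradiction (i , λ k → A.≈-sym (e≈d k)) new
              ; {suc i} {suc j} e≈e → cong suc (e-injective P e≈e)
              }
          ; f-injective = λ
              { {zero}  {zero}  _   → refl
              ; {zero}  {suc j} c≈f → contradiction (j , c≈f) new′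
              ; {suc i} {zero}  f≈c → contradiction (i , λ k → B.≈-sym (f≈c k)) new′
              ; {suc i} {suc j} f≈f → cong suc (f-injective P f≈f)
              }
          ; sizes       = 0 ∷ᵛ sizes P
          ; γ           = ∀-cons []ᵛ (γ P)
          ; δ           = ∀-cons []ᵛ (δ P)
          -- The fresh copy starts from the empty gadget position, at the current rank.
          ; γ~δ         = ∀-cons (G~H P) (γ~δ P)
          ; G~H         = G~H P
          }
        , (λ { _ _ (inBase x≈ y≈ a~b)   → inBase x≈ y≈ (keep _ _ a~b)
             ; _ _ (inCopy j x≈ y≈ v~w) → inCopy (suc j) x≈ y≈ v~w
             })
        , zero , λ _ → A.≈-refl)

    add-vertex : ∀ {p q} (P : Position A G B H p (suc q)) j v →
      ¬ ¬ (Σ[ Q ∈ Position A G B H p q ] P ⊑ Q × ∃[ y ] Match Q (inj₂ (e P j , v)) y)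
    add-vertex P j v = do
      -- All copies drop to rank `q` anyway, so `v` is played in every one, which avoids a case
      -- distinction on the copy.
      ws ← ¬¬-sequence (λ i → EFᴳ.extend (γ~δ P i) v)
      pure
        ( record
          { α = α P ; β = β P ; α~β = α~β P
          ; e = e P ; f = f P ; e~f = e~f P
          ; e-injective = e-injective P ; f-injective = f-injective P
          ; γ   = λ i → v ∷ᵛ γ P i
          ; δ   = λ i → proj₁ (ws i) ∷ᵛ δ P i
          ; γ~δ = λ i → proj₂ (ws i)
          ; G~H = EFᴳ.weaken 1 (G~H P)
          }
        , (λ { _ _ (inBase x≈ y≈ a~b)   → inBase x≈ y≈ a~b
             ; _ _ (inCopy i x≈ y≈ u~w) → inCopy i x≈ y≈ (EFᴳ.Linked-there u~w)
             })
        , inj₂ (f P j , proj₁ (ws j)) , inCopy j AG.≈-refl BH.≈-refl EFᴳ.Linked-here)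

    add-base : ∀ {p q} (P : Position A G B H (r ℕ.+ p) (suc q)) a →
      ¬ ¬ (Σ[ Q ∈ Position A G B H p q ] P ⊑ Q × ∃[ y ] Match Q (inj₁ a) y)
    add-base P a = do
      -- Playing `a` in `r` moves spends exactly the rank that opening an edge would; `r≥1` provides
      -- an answer to select.
      _ , α′ , β′ , b , α′~β′ , a~b , keep ← EFᴮ.extend-vector r (α~β P) (λ _ → a)
      pure
        ( record
          { α = α′ ; β = β′ ; α~β = α′~β′
          ; e = e P ; f = f P ; e~f = λ j i → keep _ _ (e~f P j i)
          ; e-injective = e-injective P ; f-injective = f-injective P
          ; γ = γ P ; δ = δ P ; γ~δ = λ j → EFᴳ.weaken 1 (γ~δ P j)
          ; G~H = EFᴳ.weaken 1 (G~H P)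
          }
        , (λ { _ _ (inBase x≈ y≈ a~b)   → inBase x≈ y≈ (keep _ _ a~b)
             ; _ _ (inCopy i x≈ y≈ u~w) → inCopy i x≈ y≈ u~w
             })
        , inj₁ (b (fromℕ< r≥1)) , inBase AG.≈-refl BH.≈-refl (a~b (fromℕ< r≥1)))

    forth : ∀ {p q} (P : Position A G B H (r ℕ.+ p) (suc q)) x →
      ¬ ¬ (Σ[ Q ∈ Position A G B H p q ] P ⊑ Q × ∃[ y ] Match Q x y)
    forth P (inj₁ a) = add-base P a
    forth P (inj₂ (d , v)) = do
      Q , P⊑Q , j , d≈e ← add-edge P d
      R , Q⊑R , y , ev~y ← add-vertex Q j v
      pure (R , (λ x y x~y → Q⊑R x y (P⊑Q x y x~y)) , y , Match-respˡ R (copy-cong d≈e G.≈-refl) ev~y)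
      where
      Match-respˡ : ∀ {p q} (P : Position A G B H p q) {x x′ y} → x AG.≈ x′ → Match P x′ y → Match P x y
      Match-respˡ P x≈x′ (inBase x≈ y≈ a~b)   = inBase (AG.≈-trans x≈x′ x≈) y≈ a~b
      Match-respˡ P x≈x′ (inCopy j x≈ y≈ v~w) = inCopy j (AG.≈-trans x≈x′ x≈) y≈ v~w

    -- The tuple may consist of roots and hold in a copy never opened, so its edge is added first;
    -- `Match-copy` then moves all matches into that copy.
    Match-rel : ∀ {p q} (P : Position A G B H (r ℕ.+ p) q) {S} → S ∈ Ss →
                {x : Vector AG.Carrier (arity S)} {y : Vector BH.Carrier (arity S)} →
                (∀ i → Match P (x i) (y i)) → AG.rel S x → ¬ ¬ BH.rel S y
    Match-rel P S∈ x~y (inj₁ (a , Sa , x≈a)) = do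
      b~ ← ¬¬-sequence (λ i → Match-base P (x~y i) (x≈a i))
      Sb ← EFᴮ.Linked-rel (α~β P) (there (∈-map⁺ just S∈)) (λ i → proj₁ (proj₂ (b~ i))) Sa
      pure (inj₁ (_ , Sb , λ i → proj₂ (proj₂ (b~ i))))
    Match-rel P S∈ x~y (inj₂ (d , v , Sv , x≈v)) = do
      Q , P⊑Q , j , d≈e ← add-edge P d
      w~ ← ¬¬-sequence (λ i → Match-copy Q (P⊑Q _ _ (x~y i))
                                 (AG.≈-trans (x≈v i) (copy-cong d≈e G.≈-refl)))
      Sw ← EFᴳ.Linked-rel (γ~δ Q j) S∈ (λ i → proj₁ (proj₂ (w~ i))) Sv
      pure (inj₂ (f Q j , _ , Sw , λ i → proj₂ (proj₂ (w~ i))))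

  -- One implication suffices, since the cases `⇒` and `∀′` use `flip`. The factor `suc q` grants
  -- `r` base ranks per quantifier and a last `r` for `Match-rel`.
  Sat-* : ∀ {A G B H n} (φ : Formula L 0 n) {q} (P : Position A G B H (suc q ℕ.* r) q) →
          qr φ ≤ q → (∀ {S} → S ∈ symbols φ → S ∈ Ss) →
          {σ : Vector (Structure.Carrier (A * G)) n} {τ : Vector (Structure.Carrier (B * H)) n} →
          (∀ i → Match P (σ i) (τ i)) → Sat (A * G) φ σ → Sat (B * H) φ τ
  Sat-* (var i ≐ var j) P _ _ σ~τ s = s >>= Match-≈ P (σ~τ i) (σ~τ j)
  Sat-* {A} {G} {B} {H} (atom S t) P _ S∈ σ~τ s =
    s >>= λ Sx → Match-rel P (S∈ (here refl)) (λ i → matched (t i)) Sx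
    where
    matched : ∀ u → Match P (⟦_⟧ (A * G) u _) (⟦_⟧ (B * H) u _)
    matched (var i) = σ~τ i
  Sat-* ⊥′ P _ _ σ~τ s = s
  Sat-* (φ ⇒ ψ) P qr≤ S∈ σ~τ s t =
    Sat-* ψ P (ℕ.m⊔n≤o⇒n≤o (qr φ) (qr ψ) qr≤) (λ S∈ψ → S∈ (∈-++⁺ʳ (symbols φ) S∈ψ)) σ~τ
      (s (Sat-* φ (flip P) (ℕ.m⊔n≤o⇒m≤o (qr φ) (qr ψ) qr≤) (λ S∈φ → S∈ (∈-++⁺ˡ S∈φ))
           (λ i → Match-flip P (σ~τ i)) t))
  Sat-* {B = B} {H} (∀′ φ) {suc q} P (s≤s qr≤) S∈ σ~τ s y = Sat-stable (B * H) φ do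
    Q , P⊑Q , x , y~x ← forth (flip P) y
    pure (Sat-* φ (flip Q) qr≤ S∈
      (∀-cons (Match-flip Q y~x) λ i → Match-flip Q (P⊑Q _ _ (Match-flip P (σ~τ i)))) (s x))

-- From the game to continuity

≡⇒*≡ : ∀ {L : RelationalLanguage l} {r r≥1} {A B : BaseStructure L r r≥1 ℓ} {G H : Gadget L r ℓ} k →
       A ≡[ suc k ℕ.* r ] B → Gadget.structure G ≡[ k ] Gadget.structure H →
       (A * G) ≡[ k ] (B * H)
≡⇒*≡ {ℓ = ℓ} {L = L} {r} {r≥1} {A} {B} {G} {H} k A≡B G≡H φ qr≤k = mk⇔
  (Sat-* φ start qr≤k id λ ()) (Sat-* φ (flip start) qr≤k id λ ())
  where
  open Game {L = L} r≥1 ℓ (symbols φ)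
  start : Position A G B H (suc k ℕ.* r) k
  start = record
    { α   = []ᵛ
    ; β   = []ᵛ
    ; α~β = EF.≡⇒Equivalent 0 _ A≡B
    ; e   = []ᵛ
    ; f   = []ᵛ
    ; e~f = λ ()
    ; e-injective = λ { {()} }
    ; f-injective = λ { {()} }
    ; sizes = []ᵛ
    ; γ   = λ ()
    ; δ   = λ ()
    ; γ~δ = λ ()
    ; G~H = EF.≡⇒Equivalent r _ G≡H
    }

2^-antitone : ∀ {j k} → j ≤ k → 2^- k ℚ.≤ 2^- j
2^-antitone {j} {k} j≤k =
  1/-antitone {2 ℕ.^ j} {2 ℕ.^ k} {{ℕ.m^n≢0 2 j}} {{ℕ.m^n≢0 2 k}} (ℕ.^-monoʳ-≤ 2 j≤k)
  where
  1/-antitone : ∀ {m n} .{{_ : ℕ.NonZero m}} .{{_ : ℕ.NonZero n}} → m ≤ n → ℤ.+ 1 / n ℚ.≤ ℤ.+ 1 / m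
  1/-antitone {suc m} {suc n} m≤n = ℚ.toℚᵘ-cancel-≤
    (ℚᵘ.≤-respˡ-≃ (ℚᵘ.≃-sym (ℚ.toℚᵘ-fromℚᵘ (ℚᵘ.mkℚᵘ (ℤ.+ 1) n)))
      (ℚᵘ.≤-respʳ-≃ (ℚᵘ.≃-sym (ℚ.toℚᵘ-fromℚᵘ (ℚᵘ.mkℚᵘ (ℤ.+ 1) m)))
        (ℚᵘ.*≤* (ℤ.*-monoˡ-≤-nonNeg (ℤ.+ 1) (ℤ.+≤+ m≤n)))))

-- The inequality is strict, so `2^- j` below `2^- k` forces `j > k`; the default value 1 is `2^- 0`
-- and never lies below `2^- k`.
ρ≺⇒≡ : ∀ {L : RelationalLanguage l} {c} {A B : Structure L c ℓ} {k} → ρ A B ≺ 2^- k → A ≡[ k ] B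
ρ≺⇒≡ {k = k} (nothing , 1<) = ⊥-elim (ℚ.<-irrefl refl (ℚ.<-≤-trans 1< (2^-antitone {0} {k} z≤n)))
ρ≺⇒≡ {k = k} (just (j , A≡B) , <k) φ qr≤k with ℕ.≤-total j k
... | inj₁ j≤k = ⊥-elim (ℚ.<-irrefl refl (ℚ.<-≤-trans <k (2^-antitone j≤k)))
... | inj₂ k≤j = A≡B φ (ℕ.≤-trans qr≤k k≤j)

theorem3p1 : ∀ {l : Level} (L : RelationalLanguage l) (r : ℕ) (r≥1 : 1 ≤ r) (ℓ : Level) →
    Continuous (𝓑 L r r≥1 ℓ ×ₘ 𝓖 L r ℓ) (𝓡 L ℓ) (uncurry _*_)
theorem3p1 L r r≥1 ℓ (A , G) η η>0 with 2^-<q η>0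
... | k , 2^-k<η = 2^- K , 2^->0 K , λ (B , H) (A~B , G~H) →
      just (k , ≡⇒*≡ {A = A} {B} {G} {H} k
        (λ φ qr≤ → ρ≺⇒≡ {A = A} {B} A~B φ (ℕ.≤-trans qr≤ (ℕ.m≤m+n (suc k ℕ.* r) k)))
        (λ φ qr≤ → ρ≺⇒≡ {A = Gadget.structure G} {Gadget.structure H} G~H φ
                     (ℕ.≤-trans qr≤ (ℕ.m≤n+m k (suc k ℕ.* r)))))
    , 2^-k<η
  where
  -- A common bound for the two ranks that `≡⇒*≡` asks for. It depends on `η` and `r` but not on `A`
  -- or `G`, so the continuity is uniform.
  K = suc k ℕ.* r ℕ.+ k
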